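{- For $m\ge 5$, let $n(m)$ be the minimum number of vertices of a color complete $m$-pole. Then: (a) if $m$ is odd, $m+2\le n(m)\le 10m-37$; (b) if $m$ is even, $m+2\le n(m)\le 10m-40$.
   Context: An $m$-pole ($m\ge 1$), or multipole, $M=(V,E,\mathcal{E})$ consists of a finite set $V$ of vertices, a finite collection $E$ of edges (unordered pairs of vertices; parallel edges and loops may occur), and a set $\mathcal{E}=\{\epsilon_1,\dots,\epsilon_m\}$ of $m$ semiedges. Each semiedge is either incident to exactly one vertex, or is paired with another semiedge to form a free (isolated) edge, which has no vertices. All multipoles are cubic: for each vertex, the number of edges (loops counted twice) plus semiedges incident to it is $3$. A multipole may be disconnected, and $V$ may be empty. A Tait coloring of $M$ is a map $\phi:E\cup\mathcal{E}\to\{1,2,3\}$ such that the three edges/semiedges incident with any vertex receive distinct colors (so a multipole with a loop has none) and the two semiedges of any free edge receive the same color. A state of $M$ is a tuple $(\phi(\epsilon_1),\dots,\phi(\epsilon_m))$ with $\phi$ a Tait coloring of $M$. A tuple in $\{1,2,3\}^m$ is admissible if, with $m_i$ the number of entries equal to $i$, $m_1\equiv m_2\equiv m_3\equiv m\pmod 2$. (By the Parity Lemma every state is admissible.) $M$ is color complete if every admissible tuple is a state of $M$. -}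

module Defs where

open import Data.Bool using (Bool; true; false)
open import Data.Fin using (Fin; _≟_)
open import Data.Nat using (ℕ; _+_; _≤_; _%_)
open import Data.Product using (_×_; _,_; proj₁; proj₂; Σ-syntax)
open import Data.Sum using (_⊎_; inj₁; inj₂)
open import Data.Sum.Properties using (≡-dec)
open import Data.Vec using (Vec; lookup; map; count; tabulate)
open import Relation.Binary.PropositionalEquality using (_≡_; _≢_)

-- What a semiedge is attached to: a vertex, or the other half of a free edge.
pattern vertex v = inj₁ v
pattern mate j = inj₂ j

-- The vertex set is Fin order.  An edge is stored as an ordered pair, but
-- nothing below depends on the order of its two ends; loops and parallel
-- edges are allowed.
record Multipole (m : ℕ) : Set where
  field
    order     : ℕ
    size      : ℕ
    edges     : Vec (Fin order × Fin order) size
    semiedges : Vec (Fin order ⊎ Fin m) m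

  -- A loop contributes to both of the first two summands.
  degree : Fin order → ℕ
  degree v = count (v ≟_) (map proj₁ edges)
           + count (v ≟_) (map proj₂ edges)
           + count (≡-dec _≟_ _≟_ (vertex v)) semiedges

  field
    cubic : ∀ v → degree v ≡ 3
    free  : ∀ i j → lookup semiedges i ≡ mate j →
            i ≢ j × lookup semiedges j ≡ mate i

Color : Set
Color = Fin 3

module _ {m : ℕ} (M : Multipole m) where
  open Multipole M

  -- Incidences are counted with multiplicity: every edge has two ends, so a
  -- loop is incident twice with its vertex.
  data Incidence : Set where
    edgeEnd  : Fin size → Bool → Incidence
    semiedge : Fin m → Incidence

  attachment : Incidence → Fin order ⊎ Fin m
  attachment (edgeEnd e false) = vertex (proj₁ (lookup edges e))
  attachment (edgeEnd e true)  = vertex (proj₂ (lookup edges e))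
  attachment (semiedge i)      = lookup semiedges i

  element : Incidence → Fin size ⊎ Fin m
  element (edgeEnd e _) = inj₁ e
  element (semiedge i)  = inj₂ i

  record IsTaitColoring (φ : Fin size ⊎ Fin m → Color) : Set where
    field
      -- Since the two ends of a loop are different incidences of one edge,
      -- a multipole with a loop has no Tait coloring.
      proper : ∀ v (x y : Incidence) →
               attachment x ≡ vertex v → attachment y ≡ vertex v →
               x ≢ y → φ (element x) ≢ φ (element y)
      free≡  : ∀ i j → lookup semiedges i ≡ mate j → φ (inj₂ i) ≡ φ (inj₂ j)

  IsState : Vec Color m → Set
  IsState t = Σ[ φ ∈ (Fin size ⊎ Fin m → Color) ]
              IsTaitColoring φ × t ≡ tabulate (λ i → φ (inj₂ i))

Admissible : {m : ℕ} → Vec Color m → Set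
Admissible {m} t = ∀ c → count (c ≟_) t % 2 ≡ m % 2

ColorComplete : {m : ℕ} → Multipole m → Set
ColorComplete M = ∀ t → Admissible t → IsState M t

ColorCompleteOfOrder : ℕ → ℕ → Set
ColorCompleteOfOrder m n =
  Σ[ M ∈ Multipole m ] Multipole.order M ≡ n × ColorComplete M

-- The relation "n = n(m)": at most one such n exists for each m.
IsMinimumOrder : ℕ → ℕ → Set
IsMinimumOrder m n =
  ColorCompleteOfOrder m n × (∀ k → ColorCompleteOfOrder m k → n ≤ k)

{-# OPTIONS --safe #-}
module Submission where

-- Lower bound: in a color complete M every semiedge ends at a vertex and no two
-- end at the same one, so n ≥ m, and n ≠ m + 1 by 3n = 2|E| + m.  If n = m, the
-- two further neighbors of a vertex with semiedge i have semiedges j and k; a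
-- state with colors 1 at i and 0 at j and k forces color 2 on both edges at i.
--
-- Upper bound: if two semiedges of a color complete m-pole are glued to two
-- semiedges of a 5-pole which admits every triple of colors at its remaining
-- three, then the result is a color complete (m + 1)-pole, since equal sums in
-- ℤ₂ × ℤ₂ make the two pairs and the triple interchangeable.  Starting from an
-- 11-vertex color complete 5-pole and gluing such a 7-vertex 5-pole each time
-- gives 7(m − 5) + 11 vertices.
--
-- The minimum itself exists because there are finitely many multipoles with a
-- given number of vertices and completeness is decidable.

import Data.Bool as Bool
open import Data.Bool using (Bool; true; false; not)
open import Data.Bool.Properties using (not-¬)
open import Data.Fin using (Fin; zero; suc; _≟_; _↑ˡ_; _↑ʳ_; splitAt; fromℕ<)
open import Data.Fin.Patterns
import Data.Fin.Properties as Fin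
open import Data.List using (List; []; _∷_)
open import Data.List.Relation.Unary.All using (All; all?; []; _∷_)
open import Data.List.Relation.Unary.Any using (Any; any?; here; there)
open import Data.Nat using (ℕ; zero; suc; _+_; _*_; _∸_; _≤_; _<_; _%_; z≤n; s≤s; s≤s⁻¹)
import Data.Nat as ℕ
open import Data.Nat.DivMod using ([m+n]%n≡m%n; [m+kn]%n≡m%n; %-distribˡ-+; m%n<n)
open import Data.Nat.Induction using (<-rec)
import Data.Nat.Properties as ℕ
open import Data.Nat.Tactic.RingSolver using (solve-∀)
open import Data.Product as Product using (_×_; _,_; proj₁; proj₂; ∃; Σ-syntax; ∃-syntax; uncurry)
open import Data.Sum using (_⊎_; inj₁; inj₂; [_,_]′)
open import Data.Sum.Properties using (≡-dec; inj₁-injective)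
open import Data.Vec using (Vec; []; _∷_; _++_; lookup; map; count; tabulate; replicate; _[_]≔_)
open import Data.Vec.Properties as Vec using
  ( lookup-map; lookup-++ˡ; lookup-++ʳ; lookup∘update; lookup∘update′; lookup-replicate
  ; lookup∘tabulate; tabulate∘lookup; tabulate-∘; tabulate-cong; map-++; map-∘ )
open import Function using (_∘_; mk⇔)
open import Relation.Binary.Definitions using (DecidableEquality)
open import Relation.Binary.PropositionalEquality
open import Relation.Nullary
open import Relation.Nullary.Decidable
  using (map′; decidable-stable; does-⇔; dec-false; toWitness)
open import Relation.Unary using (Decidable)
open import Algebra.Properties.CommutativeMonoid.Sum ℕ.+-0-commutativeMonoid
  using (sum; sum-cong-≗; ∑-distrib-+; sum-replicate-zero)
open import Defs

-- Decidability

-- Finiteness in the form in which it is used: exhaustive search for a witness. It passes to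
-- products, sums and vectors, so multipoles and colorings become searchable once they are coded by
-- vectors.
Searchable : Set → Set₁
Searchable A = {P : A → Set} → Decidable P → Dec (∃ P)

searchFin : ∀ {n} → Searchable (Fin n)
searchFin = Fin.any?

searchOnto : ∀ {A B : Set} (f : A → B) → (∀ b → ∃ λ a → f a ≡ b) → Searchable A → Searchable B
searchOnto f onto search {P} P? = map′
  (λ (a , p) → f a , p)
  (λ (b , p) → let (a , fa≡b) = onto b in a , subst P (sym fa≡b) p)
  (search (P? ∘ f))

searchBool : Searchable Bool
searchBool P? = map′
  [ (false ,_) , (true ,_) ]′
  (λ { (false , p) → inj₁ p ; (true , p) → inj₂ p })
  (P? false ⊎-dec P? true)

search× : ∀ {A B : Set} → Searchable A → Searchable B → Searchable (A × B)
search× searchA searchB P? = map′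
  (λ (a , b , p) → (a , b) , p)
  (λ ((a , b) , p) → a , b , p)
  (searchA λ a → searchB λ b → P? (a , b))

search⊎ : ∀ {A B : Set} → Searchable A → Searchable B → Searchable (A ⊎ B)
search⊎ searchA searchB P? = map′
  [ (λ (a , p) → inj₁ a , p) , (λ (b , p) → inj₂ b , p) ]′
  (λ { (inj₁ a , p) → inj₁ (a , p) ; (inj₂ b , p) → inj₂ (b , p) })
  (searchA (P? ∘ inj₁) ⊎-dec searchB (P? ∘ inj₂))

searchVec : ∀ {A : Set} → Searchable A → ∀ {n} → Searchable (Vec A n)
searchVec search {zero} P? = map′ ([] ,_) (λ { ([] , p) → p }) (P? [])
searchVec search {suc n} P? = map′
  (λ ((x , xs) , p) → (x ∷ xs) , p)
  (λ { ((x ∷ xs) , p) → (x , xs) , p })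
  (search× search (searchVec search) (λ (x , xs) → P? (x ∷ xs)))

searchAll : ∀ {A : Set} {P : A → Set} → Searchable A → Decidable P → Dec (∀ x → P x)
searchAll search P? = map′
  (λ none x → decidable-stable (P? x) λ ¬p → none (x , ¬p))
  (λ all (x , ¬p) → ¬p (all x))
  (¬? (search (¬? ∘ P?)))

-- Strong induction on the given witness: a bounded search either finds a smaller one to recurse on
-- or shows that this one is least.
minimum : ∀ {P : ℕ → Set} → Decidable P → ∀ {n} → P n →
          ∃[ k ] P k × k ≤ n × (∀ j → P j → k ≤ j)
minimum {P} P? {n} = <-rec (λ n → P n → ∃[ k ] P k × k ≤ n × (∀ j → P j → k ≤ j)) step n
  where
  step : ∀ n → (∀ {i} → i < n → P i → ∃[ k ] P k × k ≤ i × (∀ j → P j → k ≤ j)) →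
         P n → ∃[ k ] P k × k ≤ n × (∀ j → P j → k ≤ j)
  step n rec p with ℕ.anyUpTo? P? n
  ... | yes (i , i<n , q) = let (k , r , k≤i , least) = rec i<n q in
                            k , r , ℕ.≤-trans k≤i (ℕ.<⇒≤ i<n) , least
  ... | no none = n , p , ℕ.≤-refl , λ j q → ℕ.≮⇒≥ λ j<n → none (j , j<n , q)

module _ {m} {M : Multipole m} where

  -- The conditions on a Tait coloring only compare colors. This is what allows the finite tables
  -- below to list one coloring per orbit under permutation of the colors.
  recolor : ∀ {φ} (π : Color → Color) → (∀ {c d} → π c ≡ π d → c ≡ d) →
            IsTaitColoring M φ → IsTaitColoring M (π ∘ φ)
  recolor π π-injective tait = record
    { proper = λ v x y xv yv x≢y → proper v x y xv yv x≢y ∘ π-injective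
    ; free≡  = λ i j ij → cong π (free≡ i j ij)
    }
    where open IsTaitColoring tait

  tait-resp-≗ : ∀ {φ ψ} → φ ≗ ψ → IsTaitColoring M φ → IsTaitColoring M ψ
  tait-resp-≗ φ≗ψ tait = record
    { proper = λ v x y xv yv x≢y ψx≡ψy →
        proper v x y xv yv x≢y
          (trans (φ≗ψ (element M x)) (trans ψx≡ψy (sym (φ≗ψ (element M y)))))
    ; free≡  = λ i j ij → trans (sym (φ≗ψ (inj₂ i))) (trans (free≡ i j ij) (φ≗ψ (inj₂ j)))
    }
    where open IsTaitColoring tait

-- `IsState` with the coloring stored as a vector of edge colors, the semiedge colors being `t`
-- itself; in this form it can be decided by search.
Colorable : ∀ {m} → Multipole m → Vec Color m → Set
Colorable M t = ∃ λ es → IsTaitColoring M [ lookup es , lookup t ]′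

module _ {m} {M : Multipole m} {t : Vec Color m} where

  colorable⇒state : Colorable M t → IsState M t
  colorable⇒state (es , tait) = _ , tait , sym (tabulate∘lookup t)

  state⇒colorable : IsState M t → Colorable M t
  state⇒colorable (φ , tait , refl) = tabulate (φ ∘ inj₁) , tait-resp-≗
    (λ { (inj₁ e) → sym (lookup∘tabulate (φ ∘ inj₁) e)
       ; (inj₂ i) → sym (lookup∘tabulate (φ ∘ inj₂) i) })
    tait

module _ {m m′} {M : Multipole m} {M′ : Multipole m′} (g : Incidence M → Incidence M′) where

  -- Distinct incidences at `v′` have distinct preimages at `v` with the same colors, so properness
  -- is inherited from `v`. It serves both for a change of proof fields and for each side of a
  -- gluing.
  proper-image : (φ : Fin (Multipole.size M) ⊎ Fin m → Color)
    (φ′ : Fin (Multipole.size M′) ⊎ Fin m′ → Color) → IsTaitColoring M φ →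
    (∀ x → φ′ (element M′ (g x)) ≡ φ (element M x)) →
    ∀ v v′ →
    (∀ x′ → attachment M′ x′ ≡ vertex v′ → ∃[ x ] g x ≡ x′ × attachment M x ≡ vertex v) →
    ∀ x′ y′ → attachment M′ x′ ≡ vertex v′ → attachment M′ y′ ≡ vertex v′ →
    x′ ≢ y′ → φ′ (element M′ x′) ≢ φ′ (element M′ y′)
  proper-image φ φ′ tait color v v′ preimage x′ y′ xv yv x≢y eq
    with x , refl , xv ← preimage x′ xv | y , refl , yv ← preimage y′ yv =
    IsTaitColoring.proper {φ = φ} tait v x y xv yv (x≢y ∘ cong g)
      (trans (sym (color x)) (trans eq (color y)))

module _ {m} {M : Multipole m} where
  open Multipole M

  _≟ᵢ_ : DecidableEquality (Incidence M)
  edgeEnd e b ≟ᵢ edgeEnd f c =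
    map′ (λ { (refl , refl) → refl }) (λ { refl → refl , refl }) ((e ≟ f) ×-dec (b Bool.≟ c))
  edgeEnd _ _ ≟ᵢ semiedge _ = no λ ()
  semiedge _ ≟ᵢ edgeEnd _ _ = no λ ()
  semiedge i ≟ᵢ semiedge j  = map′ (cong semiedge) (λ { refl → refl }) (i ≟ j)

  searchIncidence : Searchable (Incidence M)
  searchIncidence = searchOnto [ uncurry edgeEnd , semiedge ]′
    (λ { (edgeEnd e b) → inj₁ (e , b) , refl ; (semiedge i) → inj₂ i , refl })
    (search⊎ (search× searchFin searchBool) searchFin)

module _ {m} (M : Multipole m) where
  open Multipole M

  tait? : ∀ φ → Dec (IsTaitColoring M φ)
  tait? φ = map′
    (λ (proper , free≡) → record
      { proper = λ v x y xv yv → proper v x xv y yv ; free≡ = free≡ })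
    (λ tait → let open IsTaitColoring tait in
      (λ v x xv y yv → proper v x y xv yv) , free≡)
    ((searchAll searchFin λ v →
      searchAll searchIncidence λ x → (attachment M x ≟ₐ vertex v) →-dec
      searchAll searchIncidence λ y → (attachment M y ≟ₐ vertex v) →-dec
      (¬? (x ≟ᵢ y) →-dec ¬? (φ (element M x) ≟ φ (element M y))))
     ×-dec
     (searchAll searchFin λ i → searchAll searchFin λ j →
      (lookup semiedges i ≟ₐ mate j) →-dec (φ (inj₂ i) ≟ φ (inj₂ j))))
    where
    _≟ₐ_ = ≡-dec _≟_ _≟_

  colorable? : Decidable (Colorable M)
  colorable? t = searchVec searchFin λ es → tait? _

admissible? : ∀ {m} → Decidable (Admissible {m})
admissible? {m} t = searchAll searchFin λ c → count (c ≟_) t % 2 ℕ.≟ m % 2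

colorComplete? : ∀ {m} (M : Multipole m) → Dec (ColorComplete M)
colorComplete? M = map′
  (λ f t adm → colorable⇒state (f t adm))
  (λ f t adm → state⇒colorable (f t adm))
  (searchAll (searchVec searchFin) λ t → admissible? t →-dec colorable? M t)

module _ {m n s} (E : Vec (Fin n × Fin n) s) (S : Vec (Fin n ⊎ Fin m) m) where

  Cubic : Set
  Cubic = ∀ v → count (v ≟_) (map proj₁ E) + count (v ≟_) (map proj₂ E)
              + count (≡-dec _≟_ _≟_ (vertex v)) S ≡ 3

  Free : Set
  Free = ∀ i j → lookup S i ≡ mate j → i ≢ j × lookup S j ≡ mate i

  build : Cubic → Free → Multipole m
  build cubic free = record { edges = E ; semiedges = S ; cubic = cubic ; free = free }

  -- Colorings depend only on `E` and `S`, but `Incidence` is indexed by the whole multipole, so the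
  -- incidences have to be renamed when the proofs of the two laws change.
  complete-irrelevant : ∀ {c f c′ f′} → ColorComplete (build c f) → ColorComplete (build c′ f′)
  complete-irrelevant {c} {f} {c′} {f′} complete t adm
    with φ , tait , t≡ ← complete t adm = φ , record
      { proper = λ v → proper-image g φ φ tait (color {φ = φ}) v v preimage
      ; free≡  = IsTaitColoring.free≡ tait } , t≡
    where
    g : Incidence (build c f) → Incidence (build c′ f′)
    g (edgeEnd e b) = edgeEnd e b
    g (semiedge i)  = semiedge i

    color : ∀ {A : Set} {φ : Fin s ⊎ Fin m → A} x →
            φ (element (build c′ f′) (g x)) ≡ φ (element (build c f) x)
    color (edgeEnd _ _) = refl
    color (semiedge _)  = refl

    preimage : ∀ {v} x′ → attachment (build c′ f′) x′ ≡ vertex v →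
               ∃[ x ] g x ≡ x′ × attachment (build c f) x ≡ vertex v
    preimage (edgeEnd e false) xv = edgeEnd e false , refl , xv
    preimage (edgeEnd e true)  xv = edgeEnd e true  , refl , xv
    preimage (semiedge i)      xv = semiedge i      , refl , xv

  buildComplete? : Dec (Σ[ c ∈ Cubic ] Σ[ f ∈ Free ] ColorComplete (build c f))
  buildComplete?
    with Fin.all? {P = λ v → count (v ≟_) (map proj₁ E) + count (v ≟_) (map proj₂ E)
              + count (≡-dec _≟_ _≟_ (vertex v)) S ≡ 3} (λ v → _ ℕ.≟ 3)
       | searchAll searchFin (λ i → searchAll searchFin (λ j →
           ≡-dec _≟_ _≟_ (lookup S i) (mate j) →-dec
           (¬? (i ≟ j) ×-dec ≡-dec _≟_ _≟_ (lookup S j) (mate i))))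
  ... | no ¬c | _     = no (¬c ∘ proj₁)
  ... | yes _ | no ¬f = no (¬f ∘ proj₁ ∘ proj₂)
  ... | yes c | yes f = map′
    (λ complete → c , f , complete)
    (λ (_ , _ , complete) → complete-irrelevant complete)
    (colorComplete? (build c f))

-- Counting

count-++ : ∀ {A : Set} {P : A → Set} (P? : Decidable P) {k l} (xs : Vec A k) (ys : Vec A l) →
           count P? (xs ++ ys) ≡ count P? xs + count P? ys
count-++ P? []       ys = refl
count-++ P? (x ∷ xs) ys with does (P? x)
... | true  = cong suc (count-++ P? xs ys)
... | false = count-++ P? xs ys

count-map : ∀ {A B : Set} {P : A → Set} {Q : B → Set}
            (P? : Decidable P) (Q? : Decidable Q) (f : A → B) →
            (∀ x → does (Q? (f x)) ≡ does (P? x)) →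
            ∀ {k} (xs : Vec A k) → count Q? (map f xs) ≡ count P? xs
count-map P? Q? f eq []       = refl
count-map P? Q? f eq (x ∷ xs) rewrite eq x | count-map P? Q? f eq xs = refl

count-vertex : ∀ {m n k} (v : Fin n) (xs : Vec (Fin n) k) →
               count (≡-dec _≟_ (_≟_ {m}) (vertex v)) (map vertex xs) ≡ count (v ≟_) xs
count-vertex {m} v = count-map (v ≟_) (≡-dec _≟_ _≟_ (vertex v)) vertex
  λ x → does-⇔ (mk⇔ inj₁-injective (cong (inj₁ {B = Fin m})))
    (≡-dec _≟_ _≟_ (vertex v) (vertex x)) (v ≟ x)

count≥1 : ∀ {A : Set} {P : A → Set} (P? : Decidable P) {k} (xs : Vec A k) →
          1 ≤ count P? xs → ∃[ i ] P (lookup xs i)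
count≥1 P? (x ∷ xs) 1≤ with P? x
... | yes p = 0F , p
... | no _  = let (i , p) = count≥1 P? xs 1≤ in suc i , p

count≥2 : ∀ {A : Set} {P : A → Set} (P? : Decidable P) {k} (xs : Vec A k) →
          2 ≤ count P? xs → ∃[ i ] ∃[ j ] i ≢ j × P (lookup xs i) × P (lookup xs j)
count≥2 P? (x ∷ xs) 2≤ with P? x
... | yes p = let (i , q) = count≥1 P? xs (s≤s⁻¹ 2≤) in 0F , suc i , (λ ()) , p , q
... | no _  = let (i , j , i≢j , p , q) = count≥2 P? xs 2≤ in
              suc i , suc j , i≢j ∘ Fin.suc-injective , p , q

sum-count : ∀ {n k} (xs : Vec (Fin n) k) → sum (λ v → count (v ≟_) xs) ≡ k
sum-count {n} []       = sum-replicate-zero n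
sum-count (x ∷ xs) = begin
  sum (λ v → count (v ≟_) (x ∷ xs))
    ≡⟨ sum-cong-≗ (λ v → count-++ (v ≟_) (x ∷ []) xs) ⟩
  sum (λ v → count (v ≟_) (x ∷ []) + count (v ≟_) xs)
    ≡⟨ ∑-distrib-+ (λ v → count (v ≟_) (x ∷ [])) _ ⟩
  sum (λ v → count (v ≟_) (x ∷ [])) + sum (λ v → count (v ≟_) xs)
    ≡⟨ cong₂ _+_ (sum-indicator x) (sum-count xs) ⟩
  suc _ ∎
  where
  open ≡-Reasoning
  sum-indicator : ∀ {n} (x : Fin n) → sum (λ v → count (v ≟_) (x ∷ [])) ≡ 1
  sum-indicator {suc n} zero    = cong suc (sum-replicate-zero n)
  sum-indicator (suc x) = trans
    (sum-cong-≗ λ v → count-map (v ≟_) (suc v ≟_) suc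
      (λ y → does-⇔ (mk⇔ Fin.suc-injective (cong suc)) (suc v ≟ suc y) (v ≟ y)) (x ∷ []))
    (sum-indicator x)

sum-const : ∀ n c → sum {n} (λ _ → c) ≡ n * c
sum-const zero    c = refl
sum-const (suc n) c = cong (c +_) (sum-const n c)

module _ {m} (M : Multipole m) where
  open Multipole M

  -- Incidences are counted in two ways: three at each vertex, two for each edge. The semiedges
  -- remain a sum over vertices, since those on free edges meet none.
  handshake : order * 3 ≡ size + size + sum (λ v → count (≡-dec _≟_ _≟_ (vertex v)) semiedges)
  handshake = begin
    order * 3                        ≡⟨ sum-const order 3 ⟨
    sum {order} (λ _ → 3)            ≡⟨ sum-cong-≗ cubic ⟨
    sum degree                       ≡⟨ ∑-distrib-+ (λ v → d₁ v + d₂ v) d₃ ⟩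
    sum (λ v → d₁ v + d₂ v) + sum d₃ ≡⟨ cong (_+ sum d₃) (∑-distrib-+ d₁ d₂) ⟩
    sum d₁ + sum d₂ + sum d₃         ≡⟨ cong₂ (λ a b → a + b + sum d₃)
                                          (sum-count (map proj₁ edges))
                                          (sum-count (map proj₂ edges)) ⟩
    size + size + sum d₃ ∎
    where
    open ≡-Reasoning
    d₁ d₂ d₃ : Fin order → ℕ
    d₁ v = count (v ≟_) (map proj₁ edges)
    d₂ v = count (v ≟_) (map proj₂ edges)
    d₃ v = count (≡-dec _≟_ _≟_ (vertex v)) semiedges

  -- Bounds the number of edges by the order, which makes the search for a multipole of given order
  -- finite.
  size≤ : size ≤ order * 3
  size≤ = subst (size ≤_) (sym handshake)
    (ℕ.≤-trans (ℕ.m≤m+n size size) (ℕ.m≤m+n (size + size) _))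

completeOfOrder? : ∀ m n → Dec (ColorCompleteOfOrder m n)
completeOfOrder? m n = map′
  (λ (s , _ , E , S , c , f , complete) → build E S c f , refl , complete)
  (λ { (M , refl , complete) → let open Multipole M in
       size , s≤s (size≤ M) , edges , semiedges , cubic , free , complete })
  -- The bound of `anyUpTo?` is strict, so `suc (n * 3)` covers every size allowed by `size≤`.
  (ℕ.anyUpTo? (λ s → searchVec (search× searchFin searchFin) λ E →
      searchVec (search⊎ searchFin searchFin) λ S → buildComplete? E S) (suc (n * 3)))

-- Lower bound

-- Pigeonhole: if `xs` hit everything, choosing an index for each value would inject `Fin m` into
-- `Fin k`.
avoid : ∀ {k m} → k < m → (xs : Vec (Fin m) k) → ∃[ l ] ∀ c → lookup xs c ≢ l
avoid k<m xs with Fin.any? (λ l → Fin.all? λ c → ¬? (lookup xs c ≟ l))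
... | yes found = found
... | no none   = contradiction (Fin.injective⇒≤ index-injective) (ℕ.<⇒≱ k<m)
  where
  covered : ∀ l → ∃[ c ] lookup xs c ≡ l
  covered l with Fin.any? (λ c → lookup xs c ≟ l)
  ... | yes hit  = hit
  ... | no  miss = contradiction (l , λ c eq → miss (c , eq)) none

  index-injective : ∀ {l l′} → proj₁ (covered l) ≡ proj₁ (covered l′) → l ≡ l′
  index-injective {l} {l′} eq =
    trans (sym (proj₂ (covered l))) (trans (cong (lookup xs) eq) (proj₂ (covered l′)))

split-↑ : ∀ m {n} (i : Fin (m + n)) → (∃[ j ] j ↑ˡ n ≡ i) ⊎ (∃[ j ] m ↑ʳ j ≡ i)
split-↑ m i with splitAt m i in eq
... | inj₁ j = inj₁ (j , Fin.splitAt⁻¹-↑ˡ eq)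
... | inj₂ j = inj₂ (j , Fin.splitAt⁻¹-↑ʳ eq)

-- A missed value `v` could be adjoined to `f`, giving an injection of `Fin (suc m)` into `Fin n`.
injective⇒surjective : ∀ {m n} {f : Fin m → Fin n} → (∀ {i j} → f i ≡ f j → i ≡ j) →
                       n ≤ m → ∀ v → ∃[ i ] f i ≡ v
injective⇒surjective {m} {n} {f} f-injective n≤m v with Fin.any? (λ i → f i ≟ v)
... | yes hit = hit
... | no miss = contradiction (Fin.injective⇒≤ g-injective) (ℕ.≤⇒≯ n≤m)
  where
  g : Fin (suc m) → Fin n
  g zero    = v
  g (suc i) = f i

  g-injective : ∀ {i j} → g i ≡ g j → i ≡ j
  g-injective {zero}  {zero}  eq = refl
  g-injective {zero}  {suc j} eq = contradiction (j , sym eq) miss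
  g-injective {suc i} {zero}  eq = contradiction (i , eq) miss
  g-injective {suc i} {suc j} eq = cong suc (f-injective eq)

-- The old entry is added on one side and the new one on the other, which avoids truncated
-- subtraction.
count-update : ∀ {A : Set} {P : A → Set} (P? : Decidable P) {k} (xs : Vec A k) i y →
               count P? (xs [ i ]≔ y) + count P? (lookup xs i ∷ []) ≡
               count P? xs + count P? (y ∷ [])
count-update P? (x ∷ xs) zero y with does (P? x) | does (P? y)
... | true  | true  = refl
... | true  | false = trans (ℕ.+-comm _ 1) (cong suc (sym (ℕ.+-identityʳ _)))
... | false | true  = trans (cong suc (ℕ.+-identityʳ _)) (sym (ℕ.+-comm _ 1))
... | false | false = refl
count-update P? (x ∷ xs) (suc i) y with does (P? x)
... | true  = cong suc (count-update P? xs i y)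
... | false = count-update P? xs i y

module _ {m} (b l : Fin m) (b≢l : b ≢ l) where

  twoSpots : Color → Vec Color m
  twoSpots y = (replicate m 0F [ b ]≔ 1F) [ l ]≔ y

  -- `count-update` twice: both overwritten entries are `0F`, the one at `l` still so after the
  -- change at `b` because `b ≢ l`.
  count-twoSpots : ∀ c y →
    count (c ≟_) (twoSpots y) + count (c ≟_) (0F ∷ 0F ∷ []) ≡
    count (c ≟_) (replicate m 0F) + count (c ≟_) (1F ∷ y ∷ [])
  count-twoSpots c y = begin
    # twoSpots y + # (0F ∷ 0F ∷ [])
      ≡⟨ cong (# twoSpots y +_) (count-++ (c ≟_) (0F ∷ []) (0F ∷ [])) ⟩
    # twoSpots y + (# (0F ∷ []) + # (0F ∷ []))
      ≡⟨ ℕ.+-assoc (# twoSpots y) _ _ ⟨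
    # twoSpots y + # (0F ∷ []) + # (0F ∷ [])
      ≡⟨ cong (λ z → # twoSpots y + # (z ∷ []) + # (0F ∷ [])) l-empty ⟨
    # twoSpots y + # (lookup u l ∷ []) + # (0F ∷ [])
      ≡⟨ cong (_+ # (0F ∷ [])) (count-update (c ≟_) u l y) ⟩
    # u + # (y ∷ []) + # (0F ∷ [])
      ≡⟨ ℕ.+-assoc (# u) _ _ ⟩
    # u + (# (y ∷ []) + # (0F ∷ []))
      ≡⟨ cong (# u +_) (ℕ.+-comm (# (y ∷ [])) _) ⟩
    # u + (# (0F ∷ []) + # (y ∷ []))
      ≡⟨ ℕ.+-assoc (# u) _ _ ⟨
    # u + # (0F ∷ []) + # (y ∷ [])
      ≡⟨ cong (λ z → # u + # (z ∷ []) + # (y ∷ [])) (lookup-replicate b 0F) ⟨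
    # u + # (lookup (replicate m 0F) b ∷ []) + # (y ∷ [])
      ≡⟨ cong (_+ # (y ∷ [])) (count-update (c ≟_) (replicate m 0F) b 1F) ⟩
    # replicate m 0F + # (1F ∷ []) + # (y ∷ [])
      ≡⟨ ℕ.+-assoc (# replicate m 0F) _ _ ⟩
    # replicate m 0F + (# (1F ∷ []) + # (y ∷ []))
      ≡⟨ cong (# replicate m 0F +_) (count-++ (c ≟_) (1F ∷ []) (y ∷ [])) ⟨
    # replicate m 0F + # (1F ∷ y ∷ []) ∎
    where
    open ≡-Reasoning
    infix 8 #_
    #_ : ∀ {k} → Vec Color k → ℕ
    #_ = count (c ≟_)
    u = replicate m 0F [ b ]≔ 1F
    l-empty : lookup u l ≡ 0F
    l-empty = trans (lookup∘update′ (b≢l ∘ sym) (replicate m 0F) 1F) (lookup-replicate l 0F)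

count-replicate : ∀ {A : Set} {P : A → Set} (P? : Decidable P) n x →
                  count P? (replicate n x) ≡ n * count P? (x ∷ [])
count-replicate P? zero x = refl
count-replicate P? (suc n) x with ih ← count-replicate P? n x | does (P? x)
... | true  = cong suc ih
... | false = ih

-- Besides b, one more spot l is recolored to restore parity: with the color of
-- b when m is even, and with the third color when m is odd.
separating : ∀ {m} → 4 ≤ m → ∀ b j k → j ≢ b → k ≢ b →
  ∃[ t ] Admissible {m} t × lookup t b ≡ 1F × lookup t j ≡ 0F × lookup t k ≡ 0F
separating {m} 4≤m b j k j≢b k≢b = conclude (m % 2) refl (m%n<n m 2)
  where
  -- `4 ≤ m` unfolds to `3 < m`, which leaves a position outside the three given ones.
  l  = proj₁ (avoid 4≤m (b ∷ j ∷ k ∷ []))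
  l≢ = proj₂ (avoid 4≤m (b ∷ j ∷ k ∷ []))

  u  = replicate m 0F [ b ]≔ 1F

  at-b : ∀ y → lookup (twoSpots b l (l≢ 0F) y) b ≡ 1F
  at-b y = trans (lookup∘update′ (l≢ 0F) u y) (lookup∘update b (replicate m 0F) 1F)

  elsewhere : ∀ y {i} → i ≢ b → i ≢ l → lookup (twoSpots b l (l≢ 0F) y) i ≡ 0F
  elsewhere y {i} i≢b i≢l =
    trans (lookup∘update′ i≢l u y)
          (trans (lookup∘update′ i≢b (replicate m 0F) 1F) (lookup-replicate i 0F))

  spots : ∀ y → Admissible (twoSpots b l (l≢ 0F) y) →
    ∃[ t ] Admissible {m} t × lookup t b ≡ 1F × lookup t j ≡ 0F × lookup t k ≡ 0F
  spots y adm = twoSpots b l (l≢ 0F) y , adm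
    , at-b y , elsewhere y j≢b (l≢ 1F) , elsewhere y k≢b (l≢ 2F)

  -- Exactly two entries leave the color `0F`, so its count keeps the parity of `m`.
  background : ∀ y → y ≢ 0F → count (0F ≟_) (twoSpots b l (l≢ 0F) y) % 2 ≡ m % 2
  background y y≢0 = begin
    n % 2       ≡⟨ [m+n]%n≡m%n n 2 ⟨
    (n + 2) % 2 ≡⟨ cong (_% 2) (n+2≡m y y≢0) ⟩
    m % 2       ∎
    where
    open ≡-Reasoning
    n = count (0F ≟_) (twoSpots b l (l≢ 0F) y)
    n+2≡m : ∀ y → y ≢ 0F → count (0F ≟_) (twoSpots b l (l≢ 0F) y) + 2 ≡ m
    n+2≡m 0F y≢0 = contradiction refl y≢0
    n+2≡m y@1F _ = trans (count-twoSpots b l (l≢ 0F) 0F y)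
      (trans (ℕ.+-identityʳ _) (trans (count-replicate (0F ≟_) m 0F) (ℕ.*-identityʳ m)))
    n+2≡m y@2F _ = trans (count-twoSpots b l (l≢ 0F) 0F y)
      (trans (ℕ.+-identityʳ _) (trans (count-replicate (0F ≟_) m 0F) (ℕ.*-identityʳ m)))

  spotted : ∀ c y → c ≢ 0F → count (c ≟_) (twoSpots b l (l≢ 0F) y) ≡ count (c ≟_) (1F ∷ y ∷ [])
  spotted 0F y c≢0 = contradiction refl c≢0
  spotted c@1F y _ = trans (sym (ℕ.+-identityʳ _)) (trans (count-twoSpots b l (l≢ 0F) c y)
    (cong (_+ _) (trans (count-replicate (c ≟_) m 0F) (ℕ.*-zeroʳ m))))
  spotted c@2F y _ = trans (sym (ℕ.+-identityʳ _)) (trans (count-twoSpots b l (l≢ 0F) c y)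
    (cong (_+ _) (trans (count-replicate (c ≟_) m 0F) (ℕ.*-zeroʳ m))))

  conclude : ∀ r → m % 2 ≡ r → r < 2 →
    ∃[ t ] Admissible {m} t × lookup t b ≡ 1F × lookup t j ≡ 0F × lookup t k ≡ 0F
  conclude 0 even _ = spots 1F λ where
    0F → background 1F λ ()
    1F → trans (cong (_% 2) (spotted 1F 1F λ ())) (sym even)
    2F → trans (cong (_% 2) (spotted 2F 1F λ ())) (sym even)
  conclude 1 odd _ = spots 2F λ where
    0F → background 2F λ ()
    1F → trans (cong (_% 2) (spotted 1F 2F λ ())) (sym odd)
    2F → trans (cong (_% 2) (spotted 2F 2F λ ())) (sym odd)
  conclude (suc (suc _)) _ (s≤s (s≤s ()))

third : ∀ {c : Color} → c ≢ 0F → c ≢ 1F → c ≡ 2F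
third {0F} c≢0 _ = contradiction refl c≢0
third {1F} _ c≢1 = contradiction refl c≢1
third {2F} _ _   = refl

module LowerBound {m} (4≤m : 4 ≤ m) (M : Multipole m) (complete : ColorComplete M) where
  open Multipole M

  -- Completeness applied to the tuple of `separating`. All contradictions with the structure of `M`
  -- below come from colorings of this kind; `j` and `k` may coincide.
  separate : ∀ b j k → j ≢ b → k ≢ b → ∃[ φ ] IsTaitColoring M φ ×
             φ (inj₂ b) ≡ 1F × φ (inj₂ j) ≡ 0F × φ (inj₂ k) ≡ 0F
  separate b j k j≢b k≢b
    with t , adm , tb , tj , tk ← separating 4≤m b j k j≢b k≢b
    with φ , tait , refl ← complete t adm =
    φ , tait , trans (sym (at b)) tb , trans (sym (at j)) tj , trans (sym (at k)) tk
    where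
    at = lookup∘tabulate (λ i → φ (inj₂ i))

  -- The two halves of a free edge would have equal colors in every state, while some state
  -- separates them.
  attached : ∀ i → ∃[ v ] lookup semiedges i ≡ vertex v
  attached i with lookup semiedges i in eq
  ... | vertex v = v , refl
  ... | mate j   =
    let i≢j , _ = free i j eq
        φ , tait , φi≡1 , φj≡0 , _ = separate i j j (i≢j ∘ sym) (i≢j ∘ sym)
    in contradiction (trans (sym φi≡1) (trans (IsTaitColoring.free≡ {φ = φ} tait i j eq) φj≡0)) λ ()

  vert : Fin m → Fin order
  vert = proj₁ ∘ attached

  -- Two semiedges at one vertex would differ in every state, but a state with its `1F` at a third
  -- semiedge `l` gives both the color `0F`.
  vert-injective : ∀ {i j} → vert i ≡ vert j → i ≡ j
  vert-injective {i} {j} eq with i ≟ j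
  ... | yes i≡j = i≡j
  ... | no  i≢j =
    let l , l≢ = avoid (ℕ.≤-trans (s≤s (s≤s (s≤s z≤n))) 4≤m) (i ∷ j ∷ [])
        φ , tait , _ , φi≡0 , φj≡0 = separate l i j (l≢ 0F) (l≢ 1F)
    in contradiction (trans φi≡0 (sym φj≡0))
      (IsTaitColoring.proper {φ = φ} tait (vert i) (semiedge i) (semiedge j)
        (proj₂ (attached i)) (trans (proj₂ (attached j)) (cong vertex (sym eq)))
        λ { refl → i≢j refl })

  m≤order : m ≤ order
  m≤order = Fin.injective⇒≤ vert-injective

  semiedges≡ : semiedges ≡ map vertex (tabulate vert)
  semiedges≡ = begin
    semiedges                   ≡⟨ tabulate∘lookup semiedges ⟨
    tabulate (lookup semiedges) ≡⟨ tabulate-cong (proj₂ ∘ attached) ⟩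
    tabulate (vertex ∘ vert)    ≡⟨ tabulate-∘ vertex vert ⟩
    map vertex (tabulate vert)  ∎
    where open ≡-Reasoning

  -- As every semiedge ends at a vertex, `handshake` says that three times the order is
  -- `2 * size + m`. For order `suc m` this would make `2 * size` equal to the odd number
  -- `suc (2 * suc m)`.
  order≢1+m : order ≢ suc m
  order≢1+m order≡ = ℕ.even≢odd size (suc m) (ℕ.+-cancelʳ-≡ m _ _ (begin
    2 * size + m        ≡⟨ cong (λ s → size + s + m) (ℕ.+-identityʳ size) ⟩
    size + size + m     ≡⟨ cong (size + size +_) (sum-count (tabulate vert)) ⟨
    size + size + sum (λ v → count (v ≟_) (tabulate vert))
                        ≡⟨ cong (size + size +_) (sum-cong-≗ λ v → sym
                             (trans (cong (count (≡-dec _≟_ _≟_ (vertex v))) semiedges≡)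
                                    (count-vertex v (tabulate vert)))) ⟩
    size + size + sum (λ v → count (≡-dec _≟_ _≟_ (vertex v)) semiedges)
                        ≡⟨ handshake M ⟨
    order * 3           ≡⟨ cong (_* 3) order≡ ⟩
    suc m * 3           ≡⟨ arithmetic m ⟩
    suc (2 * suc m) + m ∎))
    where
    open ≡-Reasoning
    arithmetic : ∀ m → suc m * 3 ≡ suc (2 * suc m) + m
    arithmetic = solve-∀

  EdgeEndAt : Fin order → Fin size × Bool → Set
  EdgeEndAt v (e , b) = attachment M (edgeEnd e b) ≡ vertex v

  edgeEnd-injective : ∀ {e f α β} → edgeEnd {M = M} e α ≡ edgeEnd f β → (e , α) ≡ (f , β)
  edgeEnd-injective refl = refl

  -- Of the three incidences at `v` at most one is a semiedge, by `vert-injective`. The other two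
  -- are found as positions in the list of all edge ends and decoded; at this point they may still
  -- be the two ends of a loop.
  two-edgeEnds : ∀ v → ∃[ x ] ∃[ y ] x ≢ y × EdgeEndAt v x × EdgeEndAt v y
  two-edgeEnds v =
    let i , j , i≢j , vi , vj = count≥2 (v ≟_) allEnds 2≤
        x , codex≡i , xv = decode i vi
        y , codey≡j , yv = decode j vj
    in x , y , (λ x≡y → i≢j (trans (sym codex≡i) (trans (cong code x≡y) codey≡j))) , xv , yv
    where
    allEnds : Vec (Fin order) (size + size)
    allEnds = map proj₁ edges ++ map proj₂ edges

    code : Fin size × Bool → Fin (size + size)
    code (e , false) = e ↑ˡ size
    code (e , true)  = size ↑ʳ e

    decode : ∀ i → v ≡ lookup allEnds i → ∃[ x ] code x ≡ i × EdgeEndAt v x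
    decode i v≡ with split-↑ size i
    ... | inj₁ (e , refl) = (e , false) , refl , cong vertex (sym (trans v≡
            (trans (lookup-++ˡ (map proj₁ edges) _ e) (lookup-map e proj₁ edges))))
    ... | inj₂ (e , refl) = (e , true) , refl , cong vertex (sym (trans v≡
            (trans (lookup-++ʳ (map proj₁ edges) _ e) (lookup-map e proj₂ edges))))

    semis = count (≡-dec _≟_ _≟_ (vertex v)) semiedges

    semis≤1 : semis ≤ 1
    semis≤1 = ℕ.≮⇒≥ λ 2≤semis →
      let i , j , i≢j , vi , vj = count≥2 (≡-dec _≟_ _≟_ (vertex v)) semiedges 2≤semis
      in i≢j (vert-injective (inj₁-injective
           (trans (sym (proj₂ (attached i))) (trans (sym vi) (trans vj (proj₂ (attached j)))))))

    2≤ : 2 ≤ count (v ≟_) allEnds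
    2≤ = ℕ.+-cancelʳ-≤ 1 2 _ (begin
      3                                ≡⟨ cubic v ⟨
      count (v ≟_) (map proj₁ edges) + count (v ≟_) (map proj₂ edges) + semis
                                       ≡⟨ cong (_+ semis) (count-++ (v ≟_) (map proj₁ edges) _) ⟨
      count (v ≟_) allEnds + semis     ≤⟨ ℕ.+-monoʳ-≤ (count (v ≟_) allEnds) semis≤1 ⟩
      count (v ≟_) allEnds + 1         ∎)
      where open ℕ.≤-Reasoning

  -- If all vertices carry semiedges, then so do the far ends of the two edges at `v`. A suitable
  -- state leaves the same single color for both edges, against properness at `v`.
  uncovered : ¬ (∀ v → ∃[ i ] vert i ≡ v)
  uncovered cover =
    let (e , α) , (f , β) , x≢y , eα , fβ = two-edgeEnds v
        j , j≡ = opposite e (not α)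
        k , k≡ = opposite f (not β)
        φ , tait , φi , φj , φk = separate i j k (i≢opposite e α eα j≡) (i≢opposite f β fβ k≡)
    in IsTaitColoring.proper {φ = φ} tait v (edgeEnd e α) (edgeEnd f β) eα fβ
         (x≢y ∘ edgeEnd-injective)
         (trans (forced φ tait φi φj e α eα j≡) (sym (forced φ tait φi φk f β fβ k≡)))
    where
    i : Fin m
    i = fromℕ< (ℕ.≤-trans (s≤s z≤n) 4≤m)

    v : Fin order
    v = vert i

    opposite : ∀ e b → ∃[ j ] attachment M (edgeEnd e b) ≡ vertex (vert j)
    opposite e false = let j , eq = cover (proj₁ (lookup edges e)) in j , cong vertex (sym eq)
    opposite e true  = let j , eq = cover (proj₂ (lookup edges e)) in j , cong vertex (sym eq)

    -- Otherwise `e` is a loop at `v`, and then no Tait coloring exists, whereas completeness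
    -- provides one.
    i≢opposite : ∀ e b {j} → attachment M (edgeEnd e b) ≡ vertex v →
                 attachment M (edgeEnd e (not b)) ≡ vertex (vert j) → j ≢ i
    i≢opposite e b eb j≡ refl =
      let l , l≢ = avoid (ℕ.≤-trans (s≤s (s≤s z≤n)) 4≤m) (i ∷ [])
          φ , tait , _ = separate i l l (l≢ 0F ∘ sym) (l≢ 0F ∘ sym)
      in IsTaitColoring.proper {φ = φ} tait v (edgeEnd e b) (edgeEnd e (not b)) eb j≡
           (λ { eq → not-¬ refl (cong side eq) }) refl
      where
      side : Incidence M → Bool
      side (edgeEnd _ b) = b
      side (semiedge _)  = false

    -- At its far end `e` meets semiedge `j` of color `0F`, at `v` it meets semiedge `i` of color
    -- `1F`.
    forced : ∀ φ → IsTaitColoring M φ → φ (inj₂ i) ≡ 1F → ∀ {j} → φ (inj₂ j) ≡ 0F →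
             ∀ e b → attachment M (edgeEnd e b) ≡ vertex v →
             attachment M (edgeEnd e (not b)) ≡ vertex (vert j) → φ (inj₁ e) ≡ 2F
    forced φ tait φi {j} φj e b eb j≡ = third
      (λ φe → proper (vert j) (edgeEnd e (not b)) (semiedge j) j≡ (proj₂ (attached j)) (λ ())
                (trans φe (sym φj)))
      (λ φe → proper v (edgeEnd e b) (semiedge i) eb (proj₂ (attached i)) (λ ())
                (trans φe (sym φi)))
      where open IsTaitColoring tait

  order≢m : order ≢ m
  order≢m order≡m = uncovered (injective⇒surjective vert-injective (ℕ.≤-reflexive order≡m))

  m+2≤order : m + 2 ≤ order
  m+2≤order = subst (_≤ order) (ℕ.+-comm 2 m)
    (ℕ.≤∧≢⇒< (ℕ.≤∧≢⇒< m≤order (order≢m ∘ sym)) (order≢1+m ∘ sym))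

-- Gluing along two semiedges

occ : ∀ {n k} → Fin n → Vec (Fin n) k → ℕ
occ v = count (v ≟_)

↑ʳ≢↑ˡ : ∀ {m n} {i : Fin n} {j : Fin m} → m ↑ʳ i ≢ j ↑ˡ n
↑ʳ≢↑ˡ {m} {n} {i} {j} eq
  with () ← trans (sym (Fin.splitAt-↑ʳ m n i)) (trans (cong (splitAt m) eq) (Fin.splitAt-↑ˡ m j n))

count-map-∁ : ∀ {A B : Set} {Q : B → Set} (Q? : Decidable Q) (f : A → B) → (∀ x → ¬ Q (f x)) →
              ∀ {k} (xs : Vec A k) → count Q? (map f xs) ≡ 0
count-map-∁ Q? f ¬Q []       = refl
count-map-∁ Q? f ¬Q (x ∷ xs) rewrite dec-false (Q? (f x)) (¬Q x) = count-map-∁ Q? f ¬Q xs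

module _ {m n : ℕ} {k l} (xs : Vec (Fin m) k) (ys : Vec (Fin n) l) where

  count-inject : ∀ v → count ((v ↑ˡ n) ≟_) (map (_↑ˡ n) xs ++ map (m ↑ʳ_) ys) ≡ count (v ≟_) xs
  count-inject v = begin
    _ ≡⟨ count-++ ((v ↑ˡ n) ≟_) (map (_↑ˡ n) xs) _ ⟩
    _ ≡⟨ cong₂ _+_
           (count-map (v ≟_) ((v ↑ˡ n) ≟_) (_↑ˡ n)
             (λ x → does-⇔ (mk⇔ (Fin.↑ˡ-injective n v x) (cong (_↑ˡ n)))
               ((v ↑ˡ n) ≟ (x ↑ˡ n)) (v ≟ x)) xs)
           (count-map-∁ ((v ↑ˡ n) ≟_) (m ↑ʳ_) (λ y → ↑ʳ≢↑ˡ ∘ sym) ys) ⟩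
    _ ≡⟨ ℕ.+-identityʳ _ ⟩
    _ ∎
    where open ≡-Reasoning

  count-raise : ∀ v → count ((m ↑ʳ v) ≟_) (map (_↑ˡ n) xs ++ map (m ↑ʳ_) ys) ≡ count (v ≟_) ys
  count-raise v = begin
    _ ≡⟨ count-++ ((m ↑ʳ v) ≟_) (map (_↑ˡ n) xs) _ ⟩
    _ ≡⟨ cong₂ _+_
           (count-map-∁ ((m ↑ʳ v) ≟_) (_↑ˡ n) (λ x → ↑ʳ≢↑ˡ) xs)
           (count-map (v ≟_) ((m ↑ʳ v) ≟_) (m ↑ʳ_)
             (λ y → does-⇔ (mk⇔ (Fin.↑ʳ-injective m v y) (cong (m ↑ʳ_)))
               ((m ↑ʳ v) ≟ (m ↑ʳ y)) (v ≟ y)) ys) ⟩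
    _ ∎
    where open ≡-Reasoning

module _ {A B C : Set} (f : A → C) (g : B → C) {k l} (xs : Vec A k) (ys : Vec B l) where

  lookup-inject : ∀ i → lookup (map f xs ++ map g ys) (i ↑ˡ l) ≡ f (lookup xs i)
  lookup-inject i = trans (lookup-++ˡ (map f xs) (map g ys) i) (lookup-map i f xs)

  lookup-raise : ∀ i → lookup (map f xs ++ map g ys) (k ↑ʳ i) ≡ g (lookup ys i)
  lookup-raise i = trans (lookup-++ʳ (map f xs) (map g ys) i) (lookup-map i g ys)

module _ {A B C : Set} (f : A → C) (g : B → C) {k l}
         (xys : Vec (A × A) k) (zws : Vec (B × B) l) where

  map-proj₁-++ : map proj₁ (map (Product.map f f) xys ++ map (Product.map g g) zws) ≡
                 map f (map proj₁ xys) ++ map g (map proj₁ zws)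
  map-proj₁-++ = trans (map-++ proj₁ (map (Product.map f f) xys) _) (cong₂ _++_
    (trans (sym (map-∘ proj₁ (Product.map f f) xys)) (map-∘ f proj₁ xys))
    (trans (sym (map-∘ proj₁ (Product.map g g) zws)) (map-∘ g proj₁ zws)))

  map-proj₂-++ : map proj₂ (map (Product.map f f) xys ++ map (Product.map g g) zws) ≡
                 map f (map proj₂ xys) ++ map g (map proj₂ zws)
  map-proj₂-++ = trans (map-++ proj₂ (map (Product.map f f) xys) _) (cong₂ _++_
    (trans (sym (map-∘ proj₂ (Product.map f f) xys)) (map-∘ f proj₂ xys))
    (trans (sym (map-∘ proj₂ (Product.map g g) zws)) (map-∘ g proj₂ zws)))

module _ {n s m} (E : Vec (Fin n × Fin n) s) (ends : Vec (Fin n) m) where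

  -- The cubic law for multipoles without free edges, whose semiedges are just a vector of vertices.
  -- Gluing is carried out in this form.
  CubicEnds : Set
  CubicEnds = ∀ v → occ v (map proj₁ E) + occ v (map proj₂ E) + occ v ends ≡ 3

  cubicEnds? : Dec CubicEnds
  cubicEnds? = Fin.all? λ v → occ v (map proj₁ E) + occ v (map proj₂ E) + occ v ends ℕ.≟ 3

  fromEnds : CubicEnds → Multipole m
  fromEnds c = record
    { edges     = E
    ; semiedges = map vertex ends
    ; cubic     = λ v → trans (cong (_ +_) (count-vertex v ends)) (c v)
    ; free      = λ i j eq → contradiction (trans (sym (lookup-map i vertex ends)) eq) λ ()
    }

module Glue {nA sA p nB sB q}
  (EA : Vec (Fin nA × Fin nA) sA) (a a′ : Fin nA) (as : Vec (Fin nA) p)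
  (cA : CubicEnds EA (a ∷ a′ ∷ as))
  (EB : Vec (Fin nB × Fin nB) sB) (b b′ : Fin nB) (bs : Vec (Fin nB) q)
  (cB : CubicEnds EB (b ∷ b′ ∷ bs))
  where

  ιA : Fin nA → Fin (nA + nB)
  ιA = _↑ˡ nB

  ιB : Fin nB → Fin (nA + nB)
  ιB = nA ↑ʳ_

  inner : Vec (Fin (nA + nB) × Fin (nA + nB)) (sA + sB)
  inner = map (Product.map ιA ιA) EA ++ map (Product.map ιB ιB) EB

  E : Vec (Fin (nA + nB) × Fin (nA + nB)) (2 + (sA + sB))
  E = (ιA a , ιB b) ∷ (ιA a′ , ιB b′) ∷ inner

  ends : Vec (Fin (nA + nB)) (p + q)
  ends = map ιA as ++ map ιB bs

  -- Gluing trades a semiedge for an end of a joining edge, so degrees do not change. The joining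
  -- edges run from A to B: `a` and `a′` move to the count of first ends, `b` and `b′` to that of
  -- second ends.
  cubicEnds : CubicEnds E ends
  cubicEnds v with split-↑ nA v
  ... | inj₁ (v , refl) = begin
    occ (ιA v) (map proj₁ E) + occ (ιA v) (map proj₂ E) + occ (ιA v) ends
      ≡⟨ cong₂ _+_ (cong₂ _+_
           (trans (count-++ (ιA v ≟_) (ιA a ∷ ιA a′ ∷ []) (map proj₁ inner))
             (cong₂ _+_ (count-inject {nA} {nB} (a ∷ a′ ∷ []) [] v)
               (trans (cong (occ (ιA v)) (map-proj₁-++ ιA ιB EA EB))
                      (count-inject (map proj₁ EA) (map proj₁ EB) v))))
           (trans (count-++ (ιA v ≟_) (ιB b ∷ ιB b′ ∷ []) (map proj₂ inner))
             (cong₂ _+_ (count-inject {nA} {nB} [] (b ∷ b′ ∷ []) v)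
               (trans (cong (occ (ιA v)) (map-proj₂-++ ιA ιB EA EB))
                      (count-inject (map proj₂ EA) (map proj₂ EB) v)))))
           (count-inject as bs v) ⟩
    occ v (a ∷ a′ ∷ []) + occ v (map proj₁ EA) + occ v (map proj₂ EA) + occ v as
      ≡⟨ arithmetic (occ v (a ∷ a′ ∷ [])) (occ v (map proj₁ EA)) (occ v (map proj₂ EA)) (occ v as) ⟩
    occ v (map proj₁ EA) + occ v (map proj₂ EA) + (occ v (a ∷ a′ ∷ []) + occ v as)
      ≡⟨ cong (occ v (map proj₁ EA) + occ v (map proj₂ EA) +_) (count-++ (v ≟_) (a ∷ a′ ∷ []) as) ⟨
    occ v (map proj₁ EA) + occ v (map proj₂ EA) + occ v (a ∷ a′ ∷ as)
      ≡⟨ cA v ⟩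
    3 ∎
    where
    open ≡-Reasoning
    arithmetic : ∀ x y z w → x + y + z + w ≡ y + z + (x + w)
    arithmetic = solve-∀
  ... | inj₂ (v , refl) = begin
    occ (ιB v) (map proj₁ E) + occ (ιB v) (map proj₂ E) + occ (ιB v) ends
      ≡⟨ cong₂ _+_ (cong₂ _+_
           (trans (count-++ (ιB v ≟_) (ιA a ∷ ιA a′ ∷ []) (map proj₁ inner))
             (cong₂ _+_ (count-raise {nA} {nB} (a ∷ a′ ∷ []) [] v)
               (trans (cong (occ (ιB v)) (map-proj₁-++ ιA ιB EA EB))
                      (count-raise (map proj₁ EA) (map proj₁ EB) v))))
           (trans (count-++ (ιB v ≟_) (ιB b ∷ ιB b′ ∷ []) (map proj₂ inner))
             (cong₂ _+_ (count-raise {nA} {nB} [] (b ∷ b′ ∷ []) v)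
               (trans (cong (occ (ιB v)) (map-proj₂-++ ιA ιB EA EB))
                      (count-raise (map proj₂ EA) (map proj₂ EB) v)))))
           (count-raise as bs v) ⟩
    occ v (map proj₁ EB) + (occ v (b ∷ b′ ∷ []) + occ v (map proj₂ EB)) + occ v bs
      ≡⟨ arithmetic (occ v (b ∷ b′ ∷ [])) (occ v (map proj₁ EB)) (occ v (map proj₂ EB)) (occ v bs) ⟩
    occ v (map proj₁ EB) + occ v (map proj₂ EB) + (occ v (b ∷ b′ ∷ []) + occ v bs)
      ≡⟨ cong (occ v (map proj₁ EB) + occ v (map proj₂ EB) +_) (count-++ (v ≟_) (b ∷ b′ ∷ []) bs) ⟨
    occ v (map proj₁ EB) + occ v (map proj₂ EB) + occ v (b ∷ b′ ∷ bs)
      ≡⟨ cB v ⟩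
    3 ∎
    where
    open ≡-Reasoning
    arithmetic : ∀ x y z w → y + (x + z) + w ≡ y + z + (x + w)
    arithmetic = solve-∀

  MA : Multipole (2 + p)
  MA = fromEnds EA (a ∷ a′ ∷ as) cA

  MB : Multipole (2 + q)
  MB = fromEnds EB (b ∷ b′ ∷ bs) cB

  M : Multipole (p + q)
  M = fromEnds E ends cubicEnds

  -- A glued semiedge turns into the half of the joining edge on its own side, `false` for A and
  -- `true` for B.
  gA : Incidence MA → Incidence M
  gA (edgeEnd e β)            = edgeEnd (2 ↑ʳ (e ↑ˡ sB)) β
  gA (semiedge 0F)            = edgeEnd 0F false
  gA (semiedge 1F)            = edgeEnd 1F false
  gA (semiedge (suc (suc i))) = semiedge (i ↑ˡ q)

  gB : Incidence MB → Incidence M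
  gB (edgeEnd e β)            = edgeEnd (2 ↑ʳ (sA ↑ʳ e)) β
  gB (semiedge 0F)            = edgeEnd 0F true
  gB (semiedge 1F)            = edgeEnd 1F true
  gB (semiedge (suc (suc i))) = semiedge (p ↑ʳ i)

  lookup-ends : ∀ i → lookup (map vertex ends) i ≡ inj₁ {B = Fin (p + q)} (lookup ends i)
  lookup-ends i = lookup-map i vertex ends

  -- Around a vertex of A the glued multipole looks as `MA` does; this is the hypothesis that
  -- `proper-image` asks for.
  preimageA : ∀ v x′ → attachment M x′ ≡ vertex (ιA v) →
              ∃[ x ] gA x ≡ x′ × attachment MA x ≡ vertex v
  preimageA v (edgeEnd 0F false) eq =
    semiedge 0F , refl , cong vertex (Fin.↑ˡ-injective nB a v (inj₁-injective eq))
  preimageA v (edgeEnd 1F false) eq =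
    semiedge 1F , refl , cong vertex (Fin.↑ˡ-injective nB a′ v (inj₁-injective eq))
  preimageA v (edgeEnd 0F true) eq = contradiction (inj₁-injective eq) ↑ʳ≢↑ˡ
  preimageA v (edgeEnd 1F true) eq = contradiction (inj₁-injective eq) ↑ʳ≢↑ˡ
  preimageA v (edgeEnd (suc (suc e)) β) eq with split-↑ sA e
  preimageA v (edgeEnd (suc (suc e)) false) eq | inj₁ (e′ , refl) =
    edgeEnd e′ false , refl , cong vertex (Fin.↑ˡ-injective nB _ v
      (trans (sym (cong proj₁ (lookup-inject _ _ EA EB e′))) (inj₁-injective eq)))
  preimageA v (edgeEnd (suc (suc e)) true) eq | inj₁ (e′ , refl) =
    edgeEnd e′ true , refl , cong vertex (Fin.↑ˡ-injective nB _ v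
      (trans (sym (cong proj₂ (lookup-inject _ _ EA EB e′))) (inj₁-injective eq)))
  preimageA v (edgeEnd (suc (suc e)) false) eq | inj₂ (e′ , refl) = contradiction
    (trans (sym (cong proj₁ (lookup-raise _ _ EA EB e′))) (inj₁-injective eq)) ↑ʳ≢↑ˡ
  preimageA v (edgeEnd (suc (suc e)) true) eq | inj₂ (e′ , refl) = contradiction
    (trans (sym (cong proj₂ (lookup-raise _ _ EA EB e′))) (inj₁-injective eq)) ↑ʳ≢↑ˡ
  preimageA v (semiedge i) eq with split-↑ p i
  ... | inj₁ (i′ , refl) = semiedge (suc (suc i′)) , refl ,
    trans (lookup-map i′ vertex as) (cong vertex (Fin.↑ˡ-injective nB _ v
      (trans (sym (lookup-inject ιA ιB as bs i′))
             (inj₁-injective (trans (sym (lookup-ends (i′ ↑ˡ q))) eq)))))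
  ... | inj₂ (i′ , refl) = contradiction
    (trans (sym (lookup-raise ιA ιB as bs i′))
           (inj₁-injective (trans (sym (lookup-ends (p ↑ʳ i′))) eq))) ↑ʳ≢↑ˡ

  preimageB : ∀ v x′ → attachment M x′ ≡ vertex (ιB v) →
              ∃[ x ] gB x ≡ x′ × attachment MB x ≡ vertex v
  preimageB v (edgeEnd 0F true) eq =
    semiedge 0F , refl , cong vertex (Fin.↑ʳ-injective nA b v (inj₁-injective eq))
  preimageB v (edgeEnd 1F true) eq =
    semiedge 1F , refl , cong vertex (Fin.↑ʳ-injective nA b′ v (inj₁-injective eq))
  preimageB v (edgeEnd 0F false) eq = contradiction (sym (inj₁-injective eq)) ↑ʳ≢↑ˡ
  preimageB v (edgeEnd 1F false) eq = contradiction (sym (inj₁-injective eq)) ↑ʳ≢↑ˡ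
  preimageB v (edgeEnd (suc (suc e)) β) eq with split-↑ sA e
  preimageB v (edgeEnd (suc (suc e)) false) eq | inj₂ (e′ , refl) =
    edgeEnd e′ false , refl , cong vertex (Fin.↑ʳ-injective nA _ v
      (trans (sym (cong proj₁ (lookup-raise _ _ EA EB e′))) (inj₁-injective eq)))
  preimageB v (edgeEnd (suc (suc e)) true) eq | inj₂ (e′ , refl) =
    edgeEnd e′ true , refl , cong vertex (Fin.↑ʳ-injective nA _ v
      (trans (sym (cong proj₂ (lookup-raise _ _ EA EB e′))) (inj₁-injective eq)))
  preimageB v (edgeEnd (suc (suc e)) false) eq | inj₁ (e′ , refl) = contradiction
    (trans (sym (inj₁-injective eq)) (cong proj₁ (lookup-inject _ _ EA EB e′))) ↑ʳ≢↑ˡ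
  preimageB v (edgeEnd (suc (suc e)) true) eq | inj₁ (e′ , refl) = contradiction
    (trans (sym (inj₁-injective eq)) (cong proj₂ (lookup-inject _ _ EA EB e′))) ↑ʳ≢↑ˡ
  preimageB v (semiedge i) eq with split-↑ p i
  ... | inj₂ (i′ , refl) = semiedge (suc (suc i′)) , refl ,
    trans (lookup-map i′ vertex bs) (cong vertex (Fin.↑ʳ-injective nA _ v
      (trans (sym (lookup-raise ιA ιB as bs i′))
             (inj₁-injective (trans (sym (lookup-ends (p ↑ʳ i′))) eq)))))
  ... | inj₁ (i′ , refl) = contradiction
    (trans (sym (inj₁-injective (trans (sym (lookup-ends (i′ ↑ˡ q))) eq)))
           (lookup-inject ιA ιB as bs i′)) ↑ʳ≢↑ˡ

  -- The two colorings agree on the glued semiedges, so the joining edges can take the colors `c`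
  -- and `c′`. Properness is local, and each vertex sees only the coloring of its own side.
  glue-colorable : ∀ {c c′} (tA : Vec Color p) (tB : Vec Color q) →
    Colorable MA (c ∷ c′ ∷ tA) → Colorable MB (c ∷ c′ ∷ tB) → Colorable M (tA ++ tB)
  glue-colorable {c} {c′} tA tB (esA , taitA) (esB , taitB) = c ∷ c′ ∷ (esA ++ esB) , record
    { proper = proper
    ; free≡  = λ i j eq → contradiction (trans (sym (lookup-ends i)) eq) λ ()
    }
    where
    φ : Fin (2 + (sA + sB)) ⊎ Fin (p + q) → Color
    φ = [ lookup (c ∷ c′ ∷ (esA ++ esB)) , lookup (tA ++ tB) ]′

    φA : Fin sA ⊎ Fin (2 + p) → Color
    φA = [ lookup esA , lookup (c ∷ c′ ∷ tA) ]′

    φB : Fin sB ⊎ Fin (2 + q) → Color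
    φB = [ lookup esB , lookup (c ∷ c′ ∷ tB) ]′

    colorA : ∀ x → φ (element M (gA x)) ≡ φA (element MA x)
    colorA (edgeEnd e β)            = lookup-++ˡ esA esB e
    colorA (semiedge 0F)            = refl
    colorA (semiedge 1F)            = refl
    colorA (semiedge (suc (suc i))) = lookup-++ˡ tA tB i

    colorB : ∀ x → φ (element M (gB x)) ≡ φB (element MB x)
    colorB (edgeEnd e β)            = lookup-++ʳ esA esB e
    colorB (semiedge 0F)            = refl
    colorB (semiedge 1F)            = refl
    colorB (semiedge (suc (suc i))) = lookup-++ʳ tA tB i

    proper : ∀ v x y → attachment M x ≡ vertex v → attachment M y ≡ vertex v →
             x ≢ y → φ (element M x) ≢ φ (element M y)
    proper v with split-↑ nA v
    ... | inj₁ (v , refl) = proper-image gA φA φ taitA colorA v (ιA v) (preimageA v)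
    ... | inj₂ (v , refl) = proper-image gB φB φ taitB colorB v (ιB v) (preimageB v)

-- Adding the two given congruences counts `x` twice, in the color counts as well as in the lengths,
-- so it vanishes modulo 2.
admissible-splice : ∀ {k p q} (w : Vec Color k) (x : Vec Color p) (y : Vec Color q) →
                    Admissible (w ++ x) → Admissible (x ++ y) → Admissible (w ++ y)
admissible-splice {k} {p} {q} w x y admwx admxy c = begin
  # (w ++ y) % 2                   ≡⟨ [m+kn]%n≡m%n (# (w ++ y)) (# x) 2 ⟨
  (# (w ++ y) + # x * 2) % 2       ≡⟨ cong (_% 2) lhs ⟩
  (# (w ++ x) + # (x ++ y)) % 2    ≡⟨ %-distribˡ-+ (# (w ++ x)) (# (x ++ y)) 2 ⟩
  (# (w ++ x) % 2 + # (x ++ y) % 2) % 2 ≡⟨ cong₂ (λ a b → (a + b) % 2) (admwx c) (admxy c) ⟩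
  ((k + p) % 2 + (p + q) % 2) % 2  ≡⟨ %-distribˡ-+ (k + p) (p + q) 2 ⟨
  (k + p + (p + q)) % 2            ≡⟨ cong (_% 2) (arithmetic k p q) ⟨
  (k + q + p * 2) % 2              ≡⟨ [m+kn]%n≡m%n (k + q) p 2 ⟩
  (k + q) % 2                      ∎
  where
  open ≡-Reasoning
  infix 8 #_
  #_ : ∀ {n} → Vec Color n → ℕ
  #_ = count (c ≟_)
  arithmetic : ∀ k p q → k + q + p * 2 ≡ k + p + (p + q)
  arithmetic = solve-∀
  lhs : # (w ++ y) + # x * 2 ≡ # (w ++ x) + # (x ++ y)
  lhs = trans (cong (_+ # x * 2) (count-++ (c ≟_) w y))
    (trans (arithmetic (# w) (# x) (# y))
      (sym (cong₂ _+_ (count-++ (c ≟_) w x) (count-++ (c ≟_) x y))))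

-- Upper bound

Recolors : ∀ {s m} → Vec Color m → Vec Color s × Vec Color m → Set
Recolors t (_ , t₀) =
  ∃[ π ] t ≡ map (lookup {n = 3} π) t₀ × (∀ c d → lookup π c ≡ lookup π d → c ≡ d)

recolors? : ∀ {s m} (t : Vec Color m) → Decidable (Recolors {s} t)
recolors? t (_ , t₀) = searchVec searchFin λ π →
  Vec.≡-dec _≟_ t (map (lookup π) t₀) ×-dec
  Fin.all? (λ c → Fin.all? (λ d → (lookup π c ≟ lookup π d) →-dec (c ≟ d)))

-- How a table certifies colorability: the permutation that carries a listed tuple to `t` also
-- carries the listed edge colors to a coloring for `t`.
recolored-colorable : ∀ {m} (M : Multipole m)
  {rows : List (Vec Color (Multipole.size M) × Vec Color m)} →
  All (λ (es , t) → IsTaitColoring M [ lookup es , lookup t ]′) rows →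
  ∀ {t} → Any (Recolors t) rows → Colorable M t
recolored-colorable M {(es , t) ∷ _} (tait ∷ _) (here (π , refl , π-injective)) =
  map (lookup π) es , tait-resp-≗ {M = M}
    (λ { (inj₁ e) → sym (lookup-map e (lookup π) es)
       ; (inj₂ i) → sym (lookup-map i (lookup π) t) })
    (recolor {M = M} (lookup π) (π-injective _ _) tait)
recolored-colorable M (_ ∷ taits) (there any) = recolored-colorable M taits any

edges₁₁ : Vec (Fin 11 × Fin 11) 14
edges₁₁ =
  (4F , 6F) ∷ (0F , 8F) ∷ (1F , 6F) ∷ (0F , 5F) ∷ (2F , 9F) ∷ (5F , 9F) ∷ (5F , 6F) ∷
  (2F , suc 9F) ∷ (4F , suc 9F) ∷ (3F , 9F) ∷ (3F , 8F) ∷ (1F , 7F) ∷ (7F , suc 9F) ∷ (7F , 8F) ∷ []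

ends₁₁ : Vec (Fin 11) 5
ends₁₁ = 0F ∷ 1F ∷ 2F ∷ 3F ∷ 4F ∷ []

-- One Tait coloring for each admissible tuple up to permuting the colors; this
-- 5-pole and the next one were found by computer search.
colorings₁₁ : List (Vec Color 14 × Vec Color 5)
colorings₁₁ =
  (0F ∷ 1F ∷ 2F ∷ 2F ∷ 1F ∷ 0F ∷ 1F ∷ 2F ∷ 1F ∷ 2F ∷ 0F ∷ 1F ∷ 0F ∷ 2F ∷ []
  , 0F ∷ 0F ∷ 0F ∷ 1F ∷ 2F ∷ []) ∷
  (0F ∷ 1F ∷ 2F ∷ 2F ∷ 2F ∷ 0F ∷ 1F ∷ 0F ∷ 1F ∷ 1F ∷ 2F ∷ 1F ∷ 2F ∷ 0F ∷ []
  , 0F ∷ 0F ∷ 1F ∷ 0F ∷ 2F ∷ []) ∷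
  (2F ∷ 2F ∷ 1F ∷ 1F ∷ 0F ∷ 2F ∷ 0F ∷ 2F ∷ 1F ∷ 1F ∷ 0F ∷ 2F ∷ 0F ∷ 1F ∷ []
  , 0F ∷ 0F ∷ 1F ∷ 2F ∷ 0F ∷ []) ∷
  (1F ∷ 2F ∷ 0F ∷ 1F ∷ 1F ∷ 0F ∷ 2F ∷ 2F ∷ 0F ∷ 2F ∷ 1F ∷ 2F ∷ 1F ∷ 0F ∷ []
  , 0F ∷ 1F ∷ 0F ∷ 0F ∷ 2F ∷ []) ∷
  (1F ∷ 2F ∷ 0F ∷ 1F ∷ 2F ∷ 0F ∷ 2F ∷ 1F ∷ 2F ∷ 1F ∷ 0F ∷ 2F ∷ 0F ∷ 1F ∷ []
  , 0F ∷ 1F ∷ 0F ∷ 2F ∷ 0F ∷ []) ∷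
  (1F ∷ 1F ∷ 2F ∷ 2F ∷ 0F ∷ 1F ∷ 0F ∷ 2F ∷ 0F ∷ 2F ∷ 0F ∷ 0F ∷ 1F ∷ 2F ∷ []
  , 0F ∷ 1F ∷ 1F ∷ 1F ∷ 2F ∷ []) ∷
  (0F ∷ 1F ∷ 2F ∷ 2F ∷ 2F ∷ 0F ∷ 1F ∷ 0F ∷ 2F ∷ 1F ∷ 0F ∷ 0F ∷ 1F ∷ 2F ∷ []
  , 0F ∷ 1F ∷ 1F ∷ 2F ∷ 1F ∷ []) ∷
  (1F ∷ 2F ∷ 0F ∷ 1F ∷ 1F ∷ 0F ∷ 2F ∷ 0F ∷ 2F ∷ 2F ∷ 1F ∷ 2F ∷ 1F ∷ 0F ∷ []
  , 0F ∷ 1F ∷ 2F ∷ 0F ∷ 0F ∷ []) ∷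
  (0F ∷ 1F ∷ 2F ∷ 2F ∷ 1F ∷ 0F ∷ 1F ∷ 0F ∷ 2F ∷ 2F ∷ 0F ∷ 0F ∷ 1F ∷ 2F ∷ []
  , 0F ∷ 1F ∷ 2F ∷ 1F ∷ 1F ∷ []) ∷
  (1F ∷ 2F ∷ 2F ∷ 1F ∷ 0F ∷ 2F ∷ 0F ∷ 1F ∷ 0F ∷ 1F ∷ 0F ∷ 0F ∷ 2F ∷ 1F ∷ []
  , 0F ∷ 1F ∷ 2F ∷ 2F ∷ 2F ∷ []) ∷ []

edges₇ : Vec (Fin 7 × Fin 7) 8
edges₇ = (2F , 3F) ∷ (1F , 6F) ∷ (4F , 5F) ∷ (0F , 4F) ∷ (5F , 6F) ∷ (2F , 5F) ∷ (0F , 1F) ∷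
  (3F , 6F) ∷ []

-- The first two ends are the ones glued in extend.
ends₇ : Vec (Fin 7) 5
ends₇ = 1F ∷ 2F ∷ 0F ∷ 3F ∷ 4F ∷ []

-- One Tait coloring for each color triple at the last three ends, up to
-- permuting the colors.
colorings₇ : List (Vec Color 8 × Vec Color 5)
colorings₇ =
  (1F ∷ 0F ∷ 2F ∷ 1F ∷ 1F ∷ 0F ∷ 2F ∷ 2F ∷ [] , 1F ∷ 2F ∷ 0F ∷ 0F ∷ 0F ∷ []) ∷
  (1F ∷ 0F ∷ 0F ∷ 2F ∷ 1F ∷ 2F ∷ 1F ∷ 2F ∷ [] , 2F ∷ 0F ∷ 0F ∷ 0F ∷ 1F ∷ []) ∷
  (0F ∷ 1F ∷ 2F ∷ 1F ∷ 0F ∷ 1F ∷ 2F ∷ 2F ∷ [] , 0F ∷ 2F ∷ 0F ∷ 1F ∷ 0F ∷ []) ∷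
  (0F ∷ 0F ∷ 0F ∷ 2F ∷ 1F ∷ 2F ∷ 1F ∷ 2F ∷ [] , 2F ∷ 1F ∷ 0F ∷ 1F ∷ 1F ∷ []) ∷
  (0F ∷ 0F ∷ 0F ∷ 1F ∷ 1F ∷ 2F ∷ 2F ∷ 2F ∷ [] , 1F ∷ 1F ∷ 0F ∷ 1F ∷ 2F ∷ []) ∷ []

cubic₁₁ : CubicEnds edges₁₁ ends₁₁
cubic₁₁ = toWitness {a? = cubicEnds? edges₁₁ ends₁₁} _

cubic₇ : CubicEnds edges₇ ends₇
cubic₇ = toWitness {a? = cubicEnds? edges₇ ends₇} _

M₁₁ M₇ : Multipole 5
M₁₁ = fromEnds edges₁₁ ends₁₁ cubic₁₁
M₇  = fromEnds edges₇ ends₇ cubic₇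

abstract
  tait₁₁ : All (λ (es , t) → IsTaitColoring M₁₁ [ lookup es , lookup t ]′) colorings₁₁
  tait₁₁ = toWitness {a? = all? (λ (es , t) → tait? M₁₁ [ lookup es , lookup t ]′) colorings₁₁} _

  tait₇ : All (λ (es , t) → IsTaitColoring M₇ [ lookup es , lookup t ]′) colorings₇
  tait₇ = toWitness {a? = all? (λ (es , t) → tait? M₇ [ lookup es , lookup t ]′) colorings₇} _

  -- Checked over all 243 tuples: the 60 admissible ones use all three colors and form ten orbits of
  -- size six, one for each row.
  exhaust₁₁ : ∀ t → Admissible t → Any (Recolors t) colorings₁₁
  exhaust₁₁ = toWitness {a? = searchAll (searchVec searchFin) λ t →
    admissible? t →-dec any? (recolors? t) colorings₁₁} _

  -- Checked over all 27 triples. One pair `w` for each triple is enough, because the color complete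
  -- side of the gluing accepts any pair of the right parity.
  exhaust₇ : (x : Vec Color 3) → Σ[ w ∈ Vec Color 2 ]
             Admissible (w ++ x) × Any (Recolors (w ++ x)) colorings₇
  exhaust₇ = toWitness {a? = searchAll (searchVec searchFin) λ (x : Vec Color 3) →
    searchVec searchFin λ (w : Vec Color 2) →
    admissible? (w ++ x) ×-dec any? (recolors? (w ++ x)) colorings₇} _

-- Color complete multipoles with their end vertices exposed, so that the first two can be split off
-- and glued.
CompletePole : ℕ → ℕ → Set
CompletePole m n = ∃[ s ] Σ[ E ∈ Vec (Fin n × Fin n) s ] Σ[ ends ∈ Vec (Fin n) m ]
  Σ[ c ∈ CubicEnds E ends ] ColorComplete (fromEnds E ends c)

extend : ∀ {q n} → CompletePole (2 + q) n → CompletePole (3 + q) (7 + n)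
extend {q} (s , EB , (b ∷ b′ ∷ bs) , cB , complete) = _ , E , ends , cubicEnds , complete′
  where
  open Glue edges₇ 1F 2F (0F ∷ 3F ∷ 4F ∷ []) cubic₇ EB b b′ bs cB

  complete′ : ColorComplete M
  complete′ (t₀ ∷ t₁ ∷ t₂ ∷ y) adm
    -- The pair `w` colors the two joining edges: the 7-vertex side realizes `w ++ x`, and
    -- completeness of the other side is applied to `w ++ y`.
    with w@(w₀ ∷ w₁ ∷ []) , adm₇ , any ← exhaust₇ (t₀ ∷ t₁ ∷ t₂ ∷ []) =
    colorable⇒state {M = M} (glue-colorable x y (recolored-colorable M₇ tait₇ any)
      (state⇒colorable {M = MB} (complete (w ++ y) (admissible-splice w x y adm₇ adm))))
    where
    x : Vec Color 3
    x = t₀ ∷ t₁ ∷ t₂ ∷ []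

-- In the form `k * 7 + 11` the order at `suc k` unfolds to `7 + (k * 7 + 11)`, as `extend` produces
-- it.
tower : ∀ k → CompletePole (5 + k) (k * 7 + 11)
tower zero    = _ , edges₁₁ , ends₁₁ , cubic₁₁ , λ t adm →
  colorable⇒state {M = M₁₁} (recolored-colorable M₁₁ tait₁₁ (exhaust₁₁ t adm))
tower (suc k) = extend (tower k)

lowerBound : ∀ {m n} → 4 ≤ m → ColorCompleteOfOrder m n → m + 2 ≤ n
lowerBound 4≤m (M , refl , complete) = LowerBound.m+2≤order 4≤m M complete

proposition3p3 : (m : ℕ) → 5 ≤ m →
    ∃[ n ] (IsMinimumOrder m n
    × (m % 2 ≡ 1 → (m + 2 ≤ n) × (n ≤ 10 * m ∸ 37))
    × (m % 2 ≡ 0 → (m + 2 ≤ n) × (n ≤ 10 * m ∸ 40)))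
proposition3p3 m 5≤m with k , refl ← ℕ.m≤n⇒∃[o]m+o≡n 5≤m =
  n , (complete , least)
    , (λ _   → lower , ℕ.≤-trans n≤ (odd k))
    , (λ m≡0 → lower , ℕ.≤-trans n≤ (even k m≡0))
  where
  existence : ColorCompleteOfOrder (5 + k) (k * 7 + 11)
  existence = let _ , E , ends , c , complete = tower k in fromEnds E ends c , refl , complete

  minimal = minimum (completeOfOrder? (5 + k)) existence

  n        = proj₁ minimal
  complete = proj₁ (proj₂ minimal)
  n≤       = proj₁ (proj₂ (proj₂ minimal))
  least    = proj₂ (proj₂ (proj₂ minimal))

  lower : 5 + k + 2 ≤ n
  lower = lowerBound (ℕ.<⇒≤ 5≤m) complete

  -- The right side is `10 * k + 13`, which leaves a slack of `2 + 3 * k`.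
  odd : ∀ k → k * 7 + 11 ≤ 10 * (5 + k) ∸ 37
  odd k = ℕ.m+n≤o⇒m≤o∸n (k * 7 + 11)
    (subst (k * 7 + 11 + 37 ≤_) (arithmetic k) (ℕ.m≤m+n _ (2 + 3 * k)))
    where
    arithmetic : ∀ k → k * 7 + 11 + 37 + (2 + 3 * k) ≡ 10 * (5 + k)
    arithmetic = solve-∀

  -- The right side is `10 * k + 10`, too small for the 11 vertices at `k = 0`; but there `m` is 5,
  -- hence not even. From `k = 1` on the inequality holds.
  even : ∀ k → (5 + k) % 2 ≡ 0 → k * 7 + 11 ≤ 10 * (5 + k) ∸ 40
  even zero    ()
  even (suc k) _ = ℕ.m+n≤o⇒m≤o∸n (suc k * 7 + 11)
    (subst (suc k * 7 + 11 + 40 ≤_) (arithmetic k) (ℕ.m≤m+n _ (2 + 3 * k)))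
    where
    arithmetic : ∀ k → suc k * 7 + 11 + 40 + (2 + 3 * k) ≡ 10 * (5 + suc k)
    arithmetic = solve-∀
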